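{- For all integers $n\geq 0$, $$a_{1^{ -1}2^{2}5^{ -1}}(5n)>0,\quad a_{1^{ -1}2^{2}5^{ -1}}(5n+1)>0,\quad a_{1^{ -1}2^{2}5^{ -1}}(5n+2)=0,$$ $$a_{1^{ -1}2^{2}5^{ -1}}(5n+3)>0,\quad a_{1^{ -1}2^{2}5^{ -1}}(5n+4)=0.$$
   Context: For $|q|<1$ (or as formal power series in $q$) let $f_j:=(q^j;q^j)_\infty=\prod_{k\ge 1}(1-q^{jk})$ for each positive integer $j$. The integers $a_{1^{ -1}2^{2}5^{ -1}}(n)$, $n\ge 0$, are defined by $\sum_{n=0}^\infty a_{1^{ -1}2^{2}5^{ -1}}(n)q^n=\dfrac{f_2^2}{f_1f_5}$. -}

module Defs where

open import Data.Nat.Base as ℕ using (ℕ; zero; suc; NonZero; z≤n; s≤s; _∸_)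
import Data.Nat.Properties as ℕ
open import Data.Integer.Base using (ℤ; 0ℤ; 1ℤ; _+_; _-_; _*_; -_)
open import Data.Integer.Properties
open import Data.Bool.Base using (true; false; T; if_then_else_)
open import Data.Fin.Base using (Fin; zero; suc; toℕ)
open import Data.Vec.Base using (Vec; []; _∷_; head; lookup)
open import Algebra.Properties.Semiring.Sum +-*-semiring
  using (sum-syntax; sum⁺-syntax; sum-cong-≗; sum-replicate-zero)
open import Relation.Nullary.Negation using (contradiction)
open import Relation.Binary.PropositionalEquality
open ≡-Reasoning

-- ℤ[[q]]: the series F stands for ∑ₙ F(n) qⁿ.
Series : Set
Series = ℕ → ℤ

infixl 6 _⊖_
infixl 7 _⊛_
infix  8 _⁻¹ q^_

q^_ : ℕ → Series
(q^ m) n = if m ℕ.≡ᵇ n then 1ℤ else 0ℤ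

_⊖_ : Series → Series → Series
(F ⊖ G) n = F n - G n

_⊛_ : Series → Series → Series
(F ⊛ G) n = ∑[ i ≤ n ] (F (toℕ i) * G (n ∸ toℕ i))

-- Reciprocal of a series with constant term 1 (see ⁻¹-inverse; meaningless
-- for other series).  Comparing coefficients in F · G = 1 gives G(0) = 1 and
-- G(n+1) = - ∑_{i≤n} F(i+1) G(n-i).  The vector reciprocalCoeffs F n lists
-- G(n-1), …, G(0), in this order.
nextCoeff : ∀ {n} → Series → Vec ℤ n → ℤ
nextCoeff         F []         = 1ℤ
nextCoeff {suc n} F gs@(_ ∷ _) = - ∑[ i ≤ n ] (F (suc (toℕ i)) * lookup gs i)

reciprocalCoeffs : Series → (n : ℕ) → Vec ℤ n
reciprocalCoeffs F zero    = []
reciprocalCoeffs F (suc n) = nextCoeff F gs ∷ gs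
  where gs = reciprocalCoeffs F n

_⁻¹ : Series → Series
(F ⁻¹) n = head (reciprocalCoeffs F (suc n))

-- ∏_{k=1}^{N} (1 - q^{jk})
partialProduct : ℕ → ℕ → Series
partialProduct j zero    = q^ 0
partialProduct j (suc N) = (q^ 0 ⊖ q^ (j ℕ.* suc N)) ⊛ partialProduct j N

-- f j = ∏_{k≥1} (1 - q^{jk}).  The factors with k > n do not affect the
-- coefficient of qⁿ, so it can be read off from the n-th partial product;
-- f-limit shows that it agrees with every later one.
f : (j : ℕ) → .{{NonZero j}} → Series
f j n = partialProduct j n n

-- The coefficients of f₂² / (f₁ f₅).
a : Series
a = (f 2 ⊛ f 2) ⊛ (f 1 ⊛ f 5) ⁻¹

lookup-reciprocalCoeffs : ∀ F n (i : Fin (suc n)) →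
  lookup (reciprocalCoeffs F (suc n)) i ≡ (F ⁻¹) (n ∸ toℕ i)
lookup-reciprocalCoeffs F n       zero    = refl
lookup-reciprocalCoeffs F (suc n) (suc i) = lookup-reciprocalCoeffs F n i

⁻¹-inverse : ∀ F → F 0 ≡ 1ℤ → F ⊛ F ⁻¹ ≗ q^ 0
⁻¹-inverse F F₀≡1 zero    rewrite F₀≡1 = refl
⁻¹-inverse F F₀≡1 (suc n) = begin
  F 0 * - S + ∑[ i ≤ n ] (F (suc (toℕ i)) * (F ⁻¹) (n ∸ toℕ i))
    ≡⟨ cong₂ _+_ (trans (cong (_* - S) F₀≡1) (*-identityˡ (- S)))
         (sum-cong-≗ λ i → cong (F (suc (toℕ i)) *_) (sym (lookup-reciprocalCoeffs F n i))) ⟩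
  - S + S
    ≡⟨ +-inverseˡ S ⟩
  0ℤ ∎
  where
  S = ∑[ i ≤ n ] (F (suc (toℕ i)) * lookup (reciprocalCoeffs F (suc n)) i)

[1-qᵐ]⊛-low : ∀ m F {n} → n ℕ.< m → ((q^ 0 ⊖ q^ m) ⊛ F) n ≡ F n
[1-qᵐ]⊛-low m F {n} n<m = begin
  (1ℤ - (q^ m) 0) * F n + ∑[ i < n ] ((0ℤ - (q^ m) (suc (toℕ i))) * F (n ∸ suc (toℕ i)))
    ≡⟨ cong₂ _+_
         (trans (cong (λ c → (1ℤ - c) * F n) (vanishes 0 (ℕ.≤-<-trans z≤n n<m)))
                (*-identityˡ (F n)))
         (trans (sum-cong-≗ λ i →
                   cong (λ c → (0ℤ - c) * F (n ∸ suc (toℕ i)))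
                        (vanishes (suc (toℕ i)) (ℕ.≤-<-trans (toℕ<n i) n<m)))
                (sum-replicate-zero n)) ⟩
  F n + 0ℤ
    ≡⟨ +-identityʳ (F n) ⟩
  F n ∎
  where
  open import Data.Fin.Properties using (toℕ<n)
  vanishes : ∀ k → k ℕ.< m → (q^ m) k ≡ 0ℤ
  vanishes k k<m with m ℕ.≡ᵇ k in eq
  ... | false = refl
  ... | true  = contradiction (ℕ.≡ᵇ⇒≡ m k (subst T (sym eq) _)) (ℕ.>⇒≢ k<m)

f-limit : ∀ j .{{_ : NonZero j}} {n N} → n ℕ.≤ N → partialProduct j N n ≡ f j n
f-limit j n≤N = go (ℕ.≤⇒≤′ n≤N)
  where
  go : ∀ {n N} → n ℕ.≤′ N → partialProduct j N n ≡ f j n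
  go ℕ.≤′-refl                 = refl
  go {n} (ℕ.≤′-step {N} n≤′N) = trans
    ([1-qᵐ]⊛-low (j ℕ.* suc N) (partialProduct j N)
      (ℕ.<-≤-trans (s≤s (ℕ.≤′⇒≤ n≤′N)) (ℕ.m≤n*m (suc N) j)))
    (go n≤′N)

-- f₁ f₅ has constant term 1, so ⁻¹ in the definition of a is the reciprocal.
f₁f₅-invertible : (f 1 ⊛ f 5) ⊛ (f 1 ⊛ f 5) ⁻¹ ≗ q^ 0
f₁f₅-invertible = ⁻¹-inverse (f 1 ⊛ f 5) refl

{-# OPTIONS --safe #-}

-- By Gauss's identity f₂² / f₁ = ψ := ∑_{s≥0} q^{s(s+1)/2}, so a is the
-- sequence of coefficients of ψ / f₅.  The exponents of ψ are ≡ 0, 1, 3 (mod 5),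
-- and division by 1 - q^{5k} does not mix residue classes and preserves signs;
-- division by 1 - q⁵ already makes every coefficient in the classes of the
-- exponents 0, 1, 3 positive.
--
-- Gauss's identity is the limit of Shanks' finite form
--   ∑_{s≤n} (∏_{s<k≤n} (1 - q^{2k})) (∏_{k≤s} (1 - q^{2k-1})) q^{s(2n+1)}
--     = (∏_{k≤n} (1 - q^{2k-1})) ∑_{s≤2n} q^{s(s+1)/2},
-- whose left-hand side is ∏_{k≤n} (1 - q^{2k}) modulo q^{2n+1}.
module Submission where

open import Defs
open import Data.Nat.Base using (ℕ; _+_; _*_)
open import Data.Integer.Base using (0ℤ; _>_)
open import Data.Product.Base using (_×_)
open import Relation.Binary.PropositionalEquality using (_≡_)

open import Algebra.Bundles using (CommutativeRing)
import Algebra.Construct.Pointwise as Pointwise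
import Algebra.Solver.Ring as RingSolver
open import Algebra.Solver.Ring.AlmostCommutativeRing
  using (fromCommutativeRing; _-Raw-AlmostCommutative⟶_)
open import Data.Bool.Base using (true; false; if_then_else_)
open import Data.Fin.Base using (toℕ)
open import Data.Fin.Properties using (toℕ≤pred[n])
open import Data.Integer.Base as ℤ using (ℤ; 1ℤ)
import Data.Integer.Properties as ℤ
import Data.Integer.Solver as ℤSolver
open import Data.Maybe.Base using (Maybe; just; nothing)
open import Data.Nat.Base as ℕ using (zero; suc; _≤_; _<_; z≤n; s≤s)
open import Data.Nat.DivMod using (_%_; [m+kn]%n≡m%n)
open import Data.Nat.Induction using (<-rec)
import Data.Nat.Properties as ℕ
import Data.Nat.Solver as ℕSolver
open import Data.Product.Base using (_,_; proj₁; proj₂)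
open import Function.Base using (_∘_)
open import Level using (0ℓ)
open import Relation.Binary.PropositionalEquality
  using (_≢_; _≗_; refl; sym; trans; cong; cong₂; subst; module ≡-Reasoning)
open import Relation.Nullary.Decidable using (yes; no)
open import Relation.Nullary.Negation using (contradiction)
open import Algebra.Properties.Semiring.Sum ℤ.+-*-semiring using (sum-cong-≗)

-- The commutative ring of formal power series over the integers.

infixl 6 _⊕_
infix  8 ⊝_

_⊕_ : Series → Series → Series
(F ⊕ G) n = F n ℤ.+ G n

⊝_ : Series → Series
(⊝ F) n = ℤ.- F n

-- With this clause, const 1ℤ is definitionally q^ 0.
const : ℤ → Series
const c n = if 0 ℕ.≡ᵇ n then c else 0ℤ

-- `(F ⊛ G) (suc n)` unfolds definitionally to `F 0 * G (suc n) + (tail F ⊛ G) n`; the ring laws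
-- below are inductions along this recursion.
tail : Series → Series
tail F = F ∘ suc

infix 4 _≈[_]_

_≈[_]_ : Series → ℕ → Series → Set
F ≈[ N ] G = ∀ {n} → n ≤ N → F n ≡ G n

-- Degree `n` of a product involves only degrees up to `n` of its factors. This lets infinite
-- products and sums be replaced by finite ones.
⊛-cong-≤ : ∀ {F F′ G G′ N} → F ≈[ N ] F′ → G ≈[ N ] G′ → F ⊛ G ≈[ N ] F′ ⊛ G′
⊛-cong-≤ F≈F′ G≈G′ {n} n≤N = sum-cong-≗ λ i → cong₂ ℤ._*_
  (F≈F′ (ℕ.≤-trans (toℕ≤pred[n] i) n≤N))
  (G≈G′ (ℕ.≤-trans (ℕ.m∸n≤m n (toℕ i)) n≤N))

⊛-cong : ∀ {F F′ G G′} → F ≗ F′ → G ≗ G′ → F ⊛ G ≗ F′ ⊛ G′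
⊛-cong F≗F′ G≗G′ n = ⊛-cong-≤ (λ {k} _ → F≗F′ k) (λ {k} _ → G≗G′ k) (ℕ.≤-refl {n})

module _ where
  open ℤSolver.+-*-Solver

  ⊛-scaleˡ : ∀ c F G → (λ n → c ℤ.* F n) ⊛ G ≗ λ n → c ℤ.* (F ⊛ G) n
  ⊛-scaleˡ c F G zero    = solve 3 (λ c x y → c :* x :* y :+ con 0ℤ := c :* (x :* y :+ con 0ℤ))
    refl c (F 0) (G 0)
  ⊛-scaleˡ c F G (suc n) = trans
    (cong₂ ℤ._+_ {x = c ℤ.* F 0 ℤ.* G (suc n)} refl (⊛-scaleˡ c (tail F) G n))
    (solve 4 (λ c x y z → c :* x :* y :+ c :* z := c :* (x :* y :+ z))
      refl c (F 0) (G (suc n)) ((tail F ⊛ G) n))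

  ⊛-distribʳ : ∀ H F G → (F ⊕ G) ⊛ H ≗ F ⊛ H ⊕ G ⊛ H
  ⊛-distribʳ H F G zero    = solve 3
    (λ h x y → (x :+ y) :* h :+ con 0ℤ := x :* h :+ con 0ℤ :+ (y :* h :+ con 0ℤ))
    refl (H 0) (F 0) (G 0)
  ⊛-distribʳ H F G (suc n) = trans
    (cong₂ ℤ._+_ {x = (F 0 ℤ.+ G 0) ℤ.* H (suc n)} refl (⊛-distribʳ H (tail F) (tail G) n))
    (solve 5 (λ h x y u v → (x :+ y) :* h :+ (u :+ v) := x :* h :+ u :+ (y :* h :+ v))
      refl (H (suc n)) (F 0) (G 0) ((tail F ⊛ H) n) ((tail G ⊛ H) n))

  -- `tail (F ⊛ G)` is definitionally `F 0` times `tail G` plus `tail F ⊛ G`, so distributivity and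
  -- scaling reduce the claim to `tail F`.
  ⊛-assoc : ∀ F G H → (F ⊛ G) ⊛ H ≗ F ⊛ (G ⊛ H)
  ⊛-assoc F G H zero    = solve 3
    (λ x y z → (x :* y :+ con 0ℤ) :* z :+ con 0ℤ := x :* (y :* z :+ con 0ℤ) :+ con 0ℤ)
    refl (F 0) (G 0) (H 0)
  ⊛-assoc F G H (suc n) = trans
    (cong₂ ℤ._+_ {x = (F 0 ℤ.* G 0 ℤ.+ 0ℤ) ℤ.* H (suc n)} refl
      (trans (⊛-distribʳ H (λ n → F 0 ℤ.* G (suc n)) (tail F ⊛ G) n)
        (cong₂ ℤ._+_ (⊛-scaleˡ (F 0) (tail G) H n) (⊛-assoc (tail F) G H n))))
    (solve 5 (λ x y z u v → (x :* y :+ con 0ℤ) :* z :+ (x :* u :+ v) := x :* (y :* z :+ u) :+ v)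
      refl (F 0) (G 0) (H (suc n)) ((tail G ⊛ H) n) ((tail F ⊛ (G ⊛ H)) n))

  -- Splits off the last summand instead of the first; comparing the two splittings gives
  -- commutativity.
  ⊛-sucʳ : ∀ F G n → (F ⊛ G) (suc n) ≡ F (suc n) ℤ.* G 0 ℤ.+ (F ⊛ tail G) n
  ⊛-sucʳ F G zero    = solve 2 (λ u v → u :+ (v :+ con 0ℤ) := v :+ (u :+ con 0ℤ))
    refl (F 0 ℤ.* G 1) (F 1 ℤ.* G 0)
  ⊛-sucʳ F G (suc n) = trans
    (cong₂ ℤ._+_ {x = F 0 ℤ.* G (suc (suc n))} refl (⊛-sucʳ (tail F) G n))
    (solve 3 (λ u v w → u :+ (v :+ w) := v :+ (u :+ w)) refl
      (F 0 ℤ.* G (suc (suc n))) (F (suc (suc n)) ℤ.* G 0) ((tail F ⊛ tail G) n))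

  ⊛-comm : ∀ F G → F ⊛ G ≗ G ⊛ F
  ⊛-comm F G zero    = cong (ℤ._+ 0ℤ) (ℤ.*-comm (F 0) (G 0))
  ⊛-comm F G (suc n) = trans
    (cong₂ ℤ._+_ (ℤ.*-comm (F 0) (G (suc n))) (⊛-comm (tail F) G n))
    (sym (⊛-sucʳ G F n))

0⊛ : ∀ F → (λ _ → 0ℤ) ⊛ F ≗ λ _ → 0ℤ
0⊛ F zero    = refl
0⊛ F (suc n) = trans (ℤ.+-identityˡ _) (0⊛ F n)

const-⊛ : ∀ c F → const c ⊛ F ≗ λ n → c ℤ.* F n
const-⊛ c F zero    = ℤ.+-identityʳ _
const-⊛ c F (suc n) = trans (cong₂ ℤ._+_ {x = c ℤ.* F (suc n)} refl (0⊛ F n)) (ℤ.+-identityʳ _)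

⊛-identityˡ : ∀ F → q^ 0 ⊛ F ≗ F
⊛-identityˡ F n = trans (const-⊛ 1ℤ F n) (ℤ.*-identityˡ (F n))

commutativeRing : CommutativeRing 0ℓ 0ℓ
commutativeRing = record
  { Carrier = Series
  ; _≈_ = _≗_
  ; _+_ = _⊕_
  ; _*_ = _⊛_
  ; -_ = ⊝_
  ; 0# = λ _ → 0ℤ
  ; 1# = q^ 0
  ; isCommutativeRing = record
    { isRing = record
      { +-isAbelianGroup = Pointwise.isAbelianGroup ℕ ℤ.+-0-isAbelianGroup
      ; *-cong = ⊛-cong
      ; *-assoc = ⊛-assoc
      ; *-identity = ⊛-identityˡ , λ F n → trans (⊛-comm F (q^ 0) n) (⊛-identityˡ F n)
      ; distrib = (λ F G H n → trans (⊛-comm F (G ⊕ H) n)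
                    (trans (⊛-distribʳ F G H n) (cong₂ ℤ._+_ (⊛-comm G F n) (⊛-comm H F n))))
                , ⊛-distribʳ
      }
    ; *-comm = ⊛-comm
    }
  }

module R = CommutativeRing commutativeRing

open import Relation.Binary.Reasoning.Setoid R.setoid

-- Gives the ring solver integer coefficients; its `con 1ℤ` then denotes `q^ 0` definitionally.
const-homomorphism : ℤ.+-*-rawRing -Raw-AlmostCommutative⟶ fromCommutativeRing commutativeRing
const-homomorphism = record
  { ⟦_⟧    = const
  ; +-homo = λ { _ _ zero → refl ; _ _ (suc _) → refl }
  ; *-homo = λ { c d zero    → sym (ℤ.+-identityʳ (c ℤ.* d))
               ; c d (suc n) → sym (trans (const-⊛ c (const d) (suc n)) (ℤ.*-zeroʳ c)) }
  ; -‿homo = λ { _ zero → refl ; _ (suc _) → refl }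
  ; 0-homo = λ { zero → refl ; (suc _) → refl }
  ; 1-homo = λ _ → refl
  }

const-≟ : ∀ c d → Maybe (const c ≗ const d)
const-≟ c d with c ℤ.≟ d
... | yes c≡d = just λ n → cong (λ x → const x n) c≡d
... | no  _   = nothing

module Solver = RingSolver ℤ.+-*-rawRing (fromCommutativeRing commutativeRing)
  const-homomorphism const-≟

-- Powers of q and congruence rules.

q^-+ : ∀ m n → q^ (m + n) ≗ q^ m ⊛ q^ n
q^-+ zero    n k       = sym (⊛-identityˡ (q^ n) k)
q^-+ (suc m) n zero    = refl
q^-+ (suc m) n (suc k) = trans (q^-+ m n k) (sym (ℤ.+-identityˡ _))

⊛-congˡ : ∀ F {G G′} → G ≗ G′ → F ⊛ G ≗ F ⊛ G′
⊛-congˡ F = ⊛-cong {F} R.refl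

⊛-congʳ : ∀ G {F F′} → F ≗ F′ → F ⊛ G ≗ F′ ⊛ G
⊛-congʳ G F≗F′ = ⊛-cong F≗F′ (R.refl {G})

⊕-congˡ : ∀ F {G G′} → G ≗ G′ → F ⊕ G ≗ F ⊕ G′
⊕-congˡ F = R.+-cong {F} R.refl

⊕-congʳ : ∀ G {F F′} → F ≗ F′ → F ⊕ G ≗ F′ ⊕ G
⊕-congʳ G F≗F′ = R.+-cong F≗F′ (R.refl {G})

1⊖-cong : ∀ {F G} → F ≗ G → q^ 0 ⊖ F ≗ q^ 0 ⊖ G
1⊖-cong F≗G n = cong (λ c → (q^ 0) n ℤ.- c) (F≗G n)

q^-cong : ∀ {m n} → m ≡ n → q^ m ≗ q^ n
q^-cong refl _ = refl

q^-low : ∀ m {n} → n < m → (q^ m) n ≡ 0ℤ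
q^-low (suc m) {zero}  _         = refl
q^-low (suc m) {suc n} (s≤s n<m) = q^-low m n<m

q^⊛-low : ∀ m F {n} → n < m → (q^ m ⊛ F) n ≡ 0ℤ
q^⊛-low (suc m) F {zero}  _         = refl
q^⊛-low (suc m) F {suc n} (s≤s n<m) = trans (ℤ.+-identityˡ _) (q^⊛-low m F n<m)

q^⊛-shift : ∀ m F n → (q^ m ⊛ F) (m + n) ≡ F n
q^⊛-shift zero    F n = ⊛-identityˡ F n
q^⊛-shift (suc m) F n = trans (ℤ.+-identityˡ _) (q^⊛-shift m F n)

-- Shanks' finite form of Gauss's identity.

oddProduct : ℕ → Series
oddProduct zero    = q^ 0
oddProduct (suc n) = (q^ 0 ⊖ q^ (1 + 2 * n)) ⊛ oddProduct n

partialProduct₁-even : ∀ n → partialProduct 1 (2 * n) ≗ oddProduct n ⊛ partialProduct 2 n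
partialProduct₁-even zero    = R.sym (⊛-identityˡ (q^ 0))
partialProduct₁-even (suc n) =
  -- Writing `2 * suc n` as `2 + 2 * n` exposes the last two factors, one with odd and one with even
  -- exponent.
  subst (λ d → partialProduct 1 d ≗ oddProduct (suc n) ⊛ partialProduct 2 (suc n))
    (sym (ℕ.*-suc 2 n)) (begin
  (q^ 0 ⊖ q^ (1 * (2 + 2 * n))) ⊛ ((q^ 0 ⊖ q^ (1 * (1 + 2 * n))) ⊛ partialProduct 1 (2 * n))
    ≈⟨ ⊛-cong (1⊖-cong (q^-cong {1 * (2 + 2 * n)} (trans (ℕ.*-identityˡ _) (sym (ℕ.*-suc 2 n)))))
         (⊛-cong (1⊖-cong (q^-cong (ℕ.*-identityˡ (1 + 2 * n)))) (partialProduct₁-even n)) ⟩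
  (q^ 0 ⊖ w) ⊛ ((q^ 0 ⊖ v) ⊛ (oddProduct n ⊛ partialProduct 2 n))
    ≈⟨ solve 4 (λ v w x y → (con 1ℤ :- w) :* ((con 1ℤ :- v) :* (x :* y))
                         := (con 1ℤ :- v) :* x :* ((con 1ℤ :- w) :* y))
         R.refl v w (oddProduct n) (partialProduct 2 n) ⟩
  oddProduct (suc n) ⊛ partialProduct 2 (suc n) ∎)
  where
  open Solver
  v = q^ (1 + 2 * n)
  w = q^ (2 * suc n)

triangular : ℕ → ℕ
triangular zero    = 0
triangular (suc n) = suc n + triangular n

triangularSum : ℕ → Series
triangularSum zero    = q^ 0
triangularSum (suc n) = triangularSum n ⊕ q^ triangular (suc n)

-- shanks m e = ∑_{s≤m} (∏_{s<k≤m} (1 - q^{2k})) (∏_{k≤s} (1 - q^{2k-1})) q^{se}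
shanks : ℕ → ℕ → Series
shanks zero    e = q^ 0
shanks (suc m) e = (q^ 0 ⊖ q^ (2 * suc m)) ⊛ shanks m e ⊕ oddProduct (suc m) ⊛ q^ (suc m * e)

-- Moves the parameter from `2 + e` to `e` at the cost of one extra term. With `e` independent of
-- `m`, it stays fixed in the induction on `m`; only `shanks-triangular` sets `e = 1 + 2 * m`.
shanks-shift : ∀ m e → (q^ 0 ⊖ q^ (1 + e)) ⊛ shanks m (2 + e) ≗
                       (q^ 0 ⊖ q^ e) ⊛ shanks m e ⊕ oddProduct (suc m) ⊛ q^ (suc m * e)
shanks-shift zero e = begin
  (q^ 0 ⊖ q^ (1 + e)) ⊛ q^ 0
    ≈⟨ ⊛-congʳ (q^ 0) (1⊖-cong (q^-+ 1 e)) ⟩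
  (q^ 0 ⊖ q^ 1 ⊛ q^ e) ⊛ q^ 0
    ≈⟨ solve 2 (λ q y → (con 1ℤ :- q :* y) :* con 1ℤ :=
                        (con 1ℤ :- y) :* con 1ℤ :+ (con 1ℤ :- q) :* con 1ℤ :* y)
         R.refl (q^ 1) (q^ e) ⟩
  (q^ 0 ⊖ q^ e) ⊛ q^ 0 ⊕ oddProduct 1 ⊛ q^ e
    ≈⟨ ⊕-congˡ ((q^ 0 ⊖ q^ e) ⊛ q^ 0) (⊛-congˡ (oddProduct 1) (q^-cong (sym (ℕ.*-identityˡ e)))) ⟩
  (q^ 0 ⊖ q^ e) ⊛ q^ 0 ⊕ oddProduct 1 ⊛ q^ (1 * e) ∎
  where open Solver
shanks-shift (suc m) e = begin
  (q^ 0 ⊖ q^ (1 + e)) ⊛ ((q^ 0 ⊖ w) ⊛ S′ ⊕ o ⊛ q^ (suc m * (2 + e)))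
    ≈⟨ ⊛-cong (1⊖-cong (q^-+ 1 e)) (⊕-congˡ ((q^ 0 ⊖ w) ⊛ S′) (⊛-congˡ o
         (R.trans (q^-cong (trans (ℕ.*-distribˡ-+ (suc m) 2 e) (cong (_+ suc m * e) (ℕ.*-comm (suc m) 2))))
                  (q^-+ (2 * suc m) (suc m * e))))) ⟩
  (q^ 0 ⊖ q ⊛ y) ⊛ ((q^ 0 ⊖ w) ⊛ S′ ⊕ o ⊛ (w ⊛ z))
    ≈⟨ solve 6 (λ q y w z o S′ →
         (con 1ℤ :- q :* y) :* ((con 1ℤ :- w) :* S′ :+ o :* (w :* z)) :=
         (con 1ℤ :- w) :* ((con 1ℤ :- q :* y) :* S′) :+ (con 1ℤ :- q :* y) :* (o :* (w :* z)))
         R.refl q y w z o S′ ⟩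
  (q^ 0 ⊖ w) ⊛ ((q^ 0 ⊖ q ⊛ y) ⊛ S′) ⊕ (q^ 0 ⊖ q ⊛ y) ⊛ (o ⊛ (w ⊛ z))
    ≈⟨ ⊕-congʳ ((q^ 0 ⊖ q ⊛ y) ⊛ (o ⊛ (w ⊛ z))) (⊛-congˡ (q^ 0 ⊖ w) (R.trans
         (⊛-congʳ S′ (1⊖-cong (R.sym (q^-+ 1 e)))) (shanks-shift m e))) ⟩
  (q^ 0 ⊖ w) ⊛ ((q^ 0 ⊖ y) ⊛ S ⊕ o ⊛ z) ⊕ (q^ 0 ⊖ q ⊛ y) ⊛ (o ⊛ (w ⊛ z))
    -- The terms in `S` agree; the remaining terms on either side amount to `o z (1 - q y w)`.
    ≈⟨ solve 6 (λ q y w z o S →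
         (con 1ℤ :- w) :* ((con 1ℤ :- y) :* S :+ o :* z) :+ (con 1ℤ :- q :* y) :* (o :* (w :* z)) :=
         (con 1ℤ :- y) :* ((con 1ℤ :- w) :* S :+ o :* z) :+ (con 1ℤ :- q :* w) :* o :* (y :* z))
         R.refl q y w z o S ⟩
  (q^ 0 ⊖ y) ⊛ ((q^ 0 ⊖ w) ⊛ S ⊕ o ⊛ z) ⊕ (q^ 0 ⊖ q ⊛ w) ⊛ o ⊛ (y ⊛ z)
    ≈⟨ ⊕-congˡ ((q^ 0 ⊖ y) ⊛ shanks (suc m) e)
         (⊛-cong (⊛-congʳ o (1⊖-cong (R.sym (q^-+ 1 (2 * suc m)))))
         (R.sym (q^-+ e (suc m * e)))) ⟩
  (q^ 0 ⊖ y) ⊛ shanks (suc m) e ⊕ oddProduct (suc (suc m)) ⊛ q^ (suc (suc m) * e) ∎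
  where
  open Solver
  q = q^ 1
  y = q^ e
  w = q^ (2 * suc m)
  z = q^ (suc m * e)
  o = oddProduct (suc m)
  S = shanks m e
  S′ = shanks m (2 + e)

-- The closed forms are the exponents `suc n * e` and `suc n * (2 + e)`, with `e = 1 + 2 * n`, that
-- arise in `shanks-triangular`.
triangular-odd : ∀ n → triangular (1 + 2 * n) ≡ suc n * (1 + 2 * n)
triangular-even : ∀ n → triangular (2 + 2 * n) ≡ suc n * (3 + 2 * n)

triangular-odd zero    = refl
triangular-odd (suc n) =
  trans (cong (triangular ∘ suc) (ℕ.*-suc 2 n)) (trans
    (cong (3 + 2 * n +_) (triangular-even n))
    (solve 1 (λ n → con 3 :+ con 2 :* n :+ (con 1 :+ n) :* (con 3 :+ con 2 :* n) :=
                    (con 2 :+ n) :* (con 1 :+ con 2 :* (con 1 :+ n))) refl n))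
  where open ℕSolver.+-*-Solver
triangular-even n = trans (cong (2 + 2 * n +_) (triangular-odd n))
  (solve 1 (λ n → con 2 :+ con 2 :* n :+ (con 1 :+ n) :* (con 1 :+ con 2 :* n) :=
                  (con 1 :+ n) :* (con 3 :+ con 2 :* n)) refl n)
  where open ℕSolver.+-*-Solver

-- With `e = 1 + 2 * n`, the factor `1 - q^(2n+2)` from unfolding `shanks (suc n)` is `1 - q^(1+e)`,
-- so `shanks-shift` applies. Its factor `1 - q^e` extends `oddProduct n` to `oddProduct (suc n)`,
-- and the two leftover terms supply the next two triangular exponents.
shanks-triangular : ∀ n → shanks n (1 + 2 * n) ≗ oddProduct n ⊛ triangularSum (2 * n)
shanks-triangular zero    = R.sym (⊛-identityˡ (q^ 0))
shanks-triangular (suc n) =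
  subst (λ d → shanks (suc n) (1 + d) ≗ oddProduct (suc n) ⊛ triangularSum d)
    (sym (ℕ.*-suc 2 n)) (begin
  (q^ 0 ⊖ q^ (2 * suc n)) ⊛ shanks n (2 + e) ⊕ o ⊛ q^ (suc n * (2 + e))
    ≈⟨ ⊕-congʳ (o ⊛ q^ (suc n * (2 + e)))
         (⊛-congʳ (shanks n (2 + e)) (1⊖-cong (q^-cong (ℕ.*-suc 2 n)))) ⟩
  (q^ 0 ⊖ q^ (1 + e)) ⊛ shanks n (2 + e) ⊕ o ⊛ q^ (suc n * (2 + e))
    ≈⟨ ⊕-congʳ (o ⊛ q^ (suc n * (2 + e))) (shanks-shift n e) ⟩
  (q^ 0 ⊖ q^ e) ⊛ shanks n e ⊕ o ⊛ q^ (suc n * e) ⊕ o ⊛ q^ (suc n * (2 + e))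
    ≈⟨ R.+-cong (R.+-cong (⊛-congˡ (q^ 0 ⊖ q^ e) (shanks-triangular n))
                  (⊛-congˡ o (q^-cong (sym (triangular-odd n)))))
                (⊛-congˡ o (q^-cong (sym (triangular-even n)))) ⟩
  (q^ 0 ⊖ q^ e) ⊛ (oddProduct n ⊛ triangularSum (2 * n)) ⊕ o ⊛ u ⊕ o ⊛ v
    ≈⟨ solve 5 (λ y p t u v →
         (con 1ℤ :- y) :* (p :* t) :+ (con 1ℤ :- y) :* p :* u :+ (con 1ℤ :- y) :* p :* v :=
         (con 1ℤ :- y) :* p :* (t :+ u :+ v))
         R.refl (q^ e) (oddProduct n) (triangularSum (2 * n)) u v ⟩
  o ⊛ triangularSum (2 + 2 * n) ∎)
  where
  open Solver
  e = 1 + 2 * n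
  o = oddProduct (suc n)
  u = q^ triangular (1 + 2 * n)
  v = q^ triangular (2 + 2 * n)

-- The summands with `s ≥ 1` are multiples of `q^(s(e+1))` and start above degree `e`; the summand
-- `s = 0` is the product on the right.
shanks-low : ∀ m e → shanks m (suc e) ≈[ e ] partialProduct 2 m
shanks-low zero    e _       = refl
shanks-low (suc m) e {n} n≤e = trans
  (cong₂ ℤ._+_
    (⊛-cong-≤ {q^ 0 ⊖ q^ (2 * suc m)} (λ _ → refl) (shanks-low m e) n≤e)
    (trans (⊛-comm (oddProduct (suc m)) (q^ (suc m * suc e)) n)
           (q^⊛-low (suc m * suc e) (oddProduct (suc m)) (ℕ.≤-trans (s≤s n≤e) (ℕ.m≤m+n (suc e) _)))))
  (ℤ.+-identityʳ _)

-- Gauss's identity in the limit.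

ψ : Series
ψ n = triangularSum n n

n≤triangular : ∀ n → n ≤ triangular n
n≤triangular zero    = z≤n
n≤triangular (suc n) = ℕ.m≤m+n (suc n) (triangular n)

-- Since `triangular s` is at least `s`, summands with `s > n` leave degree `n` unchanged. This also
-- justifies the diagonal definition of `ψ`.
ψ-limit : ∀ N → ψ ≈[ N ] triangularSum N
ψ-limit N n≤N = go (ℕ.≤⇒≤′ n≤N)
  where
  go : ∀ {n N} → n ℕ.≤′ N → ψ n ≡ triangularSum N n
  go ℕ.≤′-refl = refl
  go {n} (ℕ.≤′-step {N} n≤′N) = trans (go n≤′N) (sym (trans
    (cong₂ ℤ._+_ {x = triangularSum N n} refl
      (q^-low (triangular (suc N)) (ℕ.≤-trans (s≤s (ℕ.≤′⇒≤ n≤′N)) (n≤triangular (suc N)))))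
    (ℤ.+-identityʳ _)))

gauss : f 1 ⊛ ψ ≗ f 2 ⊛ f 2
gauss n = ≡.begin
  (f 1 ⊛ ψ) n
    -- Truncation at `2 * n` rather than `n` lets the product split evenly into odd and even
    -- exponents.
    ≡.≡⟨ ⊛-cong-≤ (λ k≤n → sym (f-limit 1 (ℕ.≤-trans k≤n n≤2n)))
                (λ k≤n → ψ-limit (2 * n) (ℕ.≤-trans k≤n n≤2n)) ℕ.≤-refl ⟩
  (partialProduct 1 (2 * n) ⊛ triangularSum (2 * n)) n
    ≡.≡⟨ ⊛-congʳ (triangularSum (2 * n)) (partialProduct₁-even n) n ⟩
  (oddProduct n ⊛ E ⊛ triangularSum (2 * n)) n
    ≡.≡⟨ solve 3 (λ x y z → x :* y :* z := x :* z :* y) R.refl (oddProduct n) E (triangularSum (2 * n)) n ⟩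
  (oddProduct n ⊛ triangularSum (2 * n) ⊛ E) n
    ≡.≡⟨ ⊛-congʳ E (shanks-triangular n) n ⟨
  (shanks n (1 + 2 * n) ⊛ E) n
    -- Up to degree `2 * n` the `shanks` factor is a second copy of `E`, and `E` agrees with `f 2`
    -- up to degree `n`.
    ≡.≡⟨ ⊛-cong-≤ (λ k≤n → trans (shanks-low n (2 * n) (ℕ.≤-trans k≤n n≤2n)) (f-limit 2 k≤n))
                (f-limit 2) ℕ.≤-refl ⟩
  (f 2 ⊛ f 2) n ≡.∎
  where
  module ≡ = ≡-Reasoning
  open Solver
  E = partialProduct 2 n
  n≤2n = ℕ.m≤m+n n (n + 0)

f₅⊛a≗ψ : f 5 ⊛ a ≗ ψ
f₅⊛a≗ψ = begin
  f 5 ⊛ ((f 2 ⊛ f 2) ⊛ I)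
    ≈⟨ ⊛-congˡ (f 5) (⊛-congʳ I gauss) ⟨
  f 5 ⊛ ((f 1 ⊛ ψ) ⊛ I)
    ≈⟨ solve 4 (λ x y p i → x :* ((y :* p) :* i) := (y :* x) :* i :* p) R.refl (f 5) (f 1) ψ I ⟩
  (f 1 ⊛ f 5) ⊛ I ⊛ ψ
    ≈⟨ ⊛-congʳ ψ f₁f₅-invertible ⟩
  q^ 0 ⊛ ψ
    ≈⟨ ⊛-identityˡ ψ ⟩
  ψ ∎
  where
  open Solver
  I = (f 1 ⊛ f 5) ⁻¹

-- Finite stages of the division of ψ by f₅.

partialProduct-constant : ∀ j .{{_ : ℕ.NonZero j}} N → partialProduct j N 0 ≡ 1ℤ
-- In degree 0 every partial product agrees with the empty one.
partialProduct-constant j N = f-limit j {N = N} z≤n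

-- Dividing by the first `N` factors of `f 5` only makes an induction possible that treats one
-- factor `1 - q^(5k)` at a time.
quotient : ℕ → Series
quotient N = partialProduct 5 N ⁻¹ ⊛ ψ

partialProduct⁻¹-cancel : ∀ N F → partialProduct 5 N ⁻¹ ⊛ (partialProduct 5 N ⊛ F) ≗ F
partialProduct⁻¹-cancel N F = begin
  P ⁻¹ ⊛ (P ⊛ F)  ≈⟨ solve 3 (λ i p x → i :* (p :* x) := p :* i :* x) R.refl (P ⁻¹) P F ⟩
  P ⊛ P ⁻¹ ⊛ F    ≈⟨ ⊛-congʳ F (⁻¹-inverse P (partialProduct-constant 5 N)) ⟩
  q^ 0 ⊛ F        ≈⟨ ⊛-identityˡ F ⟩
  F               ∎
  where
  open Solver
  P = partialProduct 5 N

-- After inserting `P ⁻¹ ⊛ P`, the factor `q^ 0 ⊖ w` joins `P` to form `P′`, which cancels `P′ ⁻¹`.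
quotient-suc : ∀ N → (q^ 0 ⊖ q^ (5 * suc N)) ⊛ quotient (suc N) ≗ quotient N
quotient-suc N = begin
  (q^ 0 ⊖ w) ⊛ quotient (suc N)
    ≈⟨ partialProduct⁻¹-cancel N _ ⟨
  P ⁻¹ ⊛ (P ⊛ ((q^ 0 ⊖ w) ⊛ (P′ ⁻¹ ⊛ ψ)))
    ≈⟨ ⊛-congˡ (P ⁻¹)
         (solve 4 (λ p w i x → p :* ((con 1ℤ :- w) :* (i :* x)) := i :* ((con 1ℤ :- w) :* p :* x))
           R.refl P w (P′ ⁻¹) ψ) ⟩
  P ⁻¹ ⊛ (P′ ⁻¹ ⊛ (P′ ⊛ ψ))
    ≈⟨ ⊛-congˡ (P ⁻¹) (partialProduct⁻¹-cancel (suc N) ψ) ⟩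
  quotient N ∎
  where
  open Solver
  P = partialProduct 5 N
  P′ = partialProduct 5 (suc N)
  w = q^ (5 * suc N)

quotient-zero : quotient 0 ≗ ψ
quotient-zero = R.trans (R.sym (⊛-identityˡ (quotient 0)))
  (R.trans (solve 3 (λ p i x → p :* (i :* x) := i :* (p :* x)) R.refl (q^ 0) ((q^ 0) ⁻¹) ψ)
           (partialProduct⁻¹-cancel 0 ψ))
  where open Solver

-- Up to degree `N`, `P` agrees with `f 5`, so there `P ⊛ a` can be replaced by `f 5 ⊛ a`, which is
-- `ψ`.
a-limit : ∀ N → a ≈[ N ] quotient N
a-limit N {n} n≤N = ≡.begin
  a n                  ≡.≡⟨ partialProduct⁻¹-cancel N a n ⟨
  (P ⁻¹ ⊛ (P ⊛ a)) n   ≡.≡⟨ ⊛-cong-≤ {P ⁻¹} (λ _ → refl)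
                             (⊛-cong-≤ {G = a} (f-limit 5) (λ _ → refl)) n≤N ⟩
  (P ⁻¹ ⊛ (f 5 ⊛ a)) n ≡.≡⟨ ⊛-congˡ (P ⁻¹) f₅⊛a≗ψ n ⟩
  quotient N n         ≡.∎
  where
  module ≡ = ≡-Reasoning
  P = partialProduct 5 N

-- Signs and zeros of the coefficients of ψ.

q^-nonNegative : ∀ m n → 0ℤ ℤ.≤ (q^ m) n
q^-nonNegative m n with m ℕ.≡ᵇ n
... | true  = ℤ.+≤+ z≤n
... | false = ℤ.+≤+ z≤n

ψ-nonNegative : ∀ n → 0ℤ ℤ.≤ ψ n
ψ-nonNegative n = go n
  where
  go : ∀ N → 0ℤ ℤ.≤ triangularSum N n
  go zero    = q^-nonNegative 0 n
  go (suc N) = ℤ.+-mono-≤ (go N) (q^-nonNegative (triangular (suc N)) n)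

q^-vanishes : ∀ m n → m ≢ n → (q^ m) n ≡ 0ℤ
q^-vanishes zero    zero    m≢n = contradiction refl m≢n
q^-vanishes zero    (suc n) m≢n = refl
q^-vanishes (suc m) zero    m≢n = refl
q^-vanishes (suc m) (suc n) m≢n = q^-vanishes m n (m≢n ∘ cong suc)

ψ-vanishes : ∀ n → (∀ s → triangular s ≢ n) → ψ n ≡ 0ℤ
ψ-vanishes n nontriangular = go n
  where
  go : ∀ N → triangularSum N n ≡ 0ℤ
  go zero    = q^-vanishes 0 n (nontriangular 0)
  go (suc N) = cong₂ ℤ._+_ (go N) (q^-vanishes (triangular (suc N)) n (nontriangular (suc N)))

-- The five increments `1 + s` to `5 + s` add up to `5 (s + 3)`.
triangular-%5 : ∀ s → triangular (5 + s) % 5 ≡ triangular s % 5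
triangular-%5 s = trans
  (cong (_% 5) (solve 2 (λ s t → con 5 :+ s :+ (con 4 :+ s :+ (con 3 :+ s :+ (con 2 :+ s :+ (con 1 :+ s :+ t))))
                              := t :+ (con 3 :+ s) :* con 5) refl s (triangular s)))
  ([m+kn]%n≡m%n (triangular s) (3 + s) 5)
  where open ℕSolver.+-*-Solver

-- By periodicity only 0, 1, 3, 6, 10 matter, with residues 0, 1, 3, 1, 0.
triangular-%5∉2,4 : ∀ s → triangular s % 5 ≢ 2 × triangular s % 5 ≢ 4
triangular-%5∉2,4 0 = (λ ()) , (λ ())
triangular-%5∉2,4 1 = (λ ()) , (λ ())
triangular-%5∉2,4 2 = (λ ()) , (λ ())
triangular-%5∉2,4 3 = (λ ()) , (λ ())
triangular-%5∉2,4 4 = (λ ()) , (λ ())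
triangular-%5∉2,4 (suc (suc (suc (suc (suc s))))) =
  subst (λ r → r ≢ 2 × r ≢ 4) (sym (triangular-%5 s)) (triangular-%5∉2,4 s)

[5n+r]%5 : ∀ n r → (5 * n + r) % 5 ≡ r % 5
[5n+r]%5 n r = trans (cong (_% 5) (trans (ℕ.+-comm (5 * n) r) (cong (r +_) (ℕ.*-comm 5 n))))
                     ([m+kn]%n≡m%n r n 5)

ψ[5n+2]≡0 : ∀ n → ψ (5 * n + 2) ≡ 0ℤ
ψ[5n+2]≡0 n = ψ-vanishes (5 * n + 2) λ s eq →
  proj₁ (triangular-%5∉2,4 s) (trans (cong (_% 5) eq) ([5n+r]%5 n 2))

ψ[5n+4]≡0 : ∀ n → ψ (5 * n + 4) ≡ 0ℤ
ψ[5n+4]≡0 n = ψ-vanishes (5 * n + 4) λ s eq →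
  proj₂ (triangular-%5∉2,4 s) (trans (cong (_% 5) eq) ([5n+r]%5 n 4))

-- Division by 1 - q^(5k) within a residue class modulo 5.

[1-qᵐ]⊛-shift : ∀ m F {G} → (q^ 0 ⊖ q^ m) ⊛ F ≗ G → ∀ n → F (m + n) ≡ F n ℤ.+ G (m + n)
[1-qᵐ]⊛-shift m F {G} eq n = ≡.begin
  F (m + n)
    -- The equation is read as the recursion `F = q^m F + G`.
    ≡.≡⟨ solve 2 (λ w x → x := w :* x :+ (con 1ℤ :- w) :* x) R.refl (q^ m) F (m + n) ⟩
  (q^ m ⊛ F) (m + n) ℤ.+ ((q^ 0 ⊖ q^ m) ⊛ F) (m + n)
    ≡.≡⟨ cong₂ ℤ._+_ (q^⊛-shift m F n) (eq (m + n)) ⟩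
  F n ℤ.+ G (m + n) ≡.∎
  where
  module ≡ = ≡-Reasoning
  open Solver

module _ {r} (r<5 : r < 5) where

  5n+r<5k : ∀ {n k} → n < k → 5 * n + r < 5 * k
  5n+r<5k {n} {k} n<k = ℕ.<-≤-trans (ℕ.+-monoʳ-< (5 * n) r<5)
    (subst (_≤ 5 * k) (trans (ℕ.*-suc 5 n) (ℕ.+-comm 5 (5 * n))) (ℕ.*-monoʳ-≤ 5 n<k))

  quotient-low : ∀ N {n} → n < suc N → quotient (suc N) (5 * n + r) ≡ quotient N (5 * n + r)
  quotient-low N {n} n≤N =
    trans (sym ([1-qᵐ]⊛-low (5 * suc N) (quotient (suc N)) (5n+r<5k n≤N))) (quotient-suc N (5 * n + r))

  quotient-shift : ∀ N n → quotient (suc N) (5 * (suc N + n) + r) ≡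
                           quotient (suc N) (5 * n + r) ℤ.+ quotient N (5 * (suc N + n) + r)
  quotient-shift N n = subst (λ m → quotient (suc N) m ≡ quotient (suc N) (5 * n + r) ℤ.+ quotient N m)
    (trans (sym (ℕ.+-assoc (5 * suc N) (5 * n) r)) (cong (_+ r) (sym (ℕ.*-distribˡ-+ 5 (suc N) n))))
    ([1-qᵐ]⊛-shift (5 * suc N) (quotient (suc N)) (quotient-suc N) (5 * n + r))

  -- Each new coefficient is either an old one, below degree `5 (N + 1)`, or the sum of an old one
  -- and an earlier new one in the same class. Strong induction is used because the recursion goes
  -- back `suc N` places. It serves both positivity and vanishing.
  quotient-closed : (P : ℤ → Set) → (∀ {x y} → P x → P y → P (x ℤ.+ y)) → ∀ N →
                    (∀ n → P (quotient N (5 * n + r))) → ∀ n → P (quotient (suc N) (5 * n + r))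
  quotient-closed P P-+ N PN = <-rec _ step
    where
    step : ∀ n → (∀ {m} → m < n → P (quotient (suc N) (5 * m + r))) → P (quotient (suc N) (5 * n + r))
    step n ih with n ℕ.<? suc N
    ... | yes n≤N = subst P (sym (quotient-low N n≤N)) (PN n)
    ... | no  n≰N with ℕ.m≤n⇒∃[o]m+o≡n (ℕ.≮⇒≥ n≰N)
    ...   | m , refl = subst P (sym (quotient-shift N m))
                         (P-+ (ih (s≤s (ℕ.m≤n+m m N))) (PN (suc N + m)))

  -- The index starts at `suc N` because `ψ` itself has gaps. Division by `1 - q^5` fills them: each
  -- coefficient is its positive predecessor in the class plus a nonnegative coefficient of `ψ`.
  -- Later divisions preserve positivity.
  quotient-positive : ψ r > 0ℤ → ∀ N n → quotient (suc N) (5 * n + r) > 0ℤ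
  quotient-positive ψr>0 zero    zero    =
    subst (_> 0ℤ) (sym (trans (quotient-low 0 (s≤s z≤n)) (quotient-zero r))) ψr>0
  quotient-positive ψr>0 zero    (suc n) =
    subst (_> 0ℤ) (sym (quotient-shift 0 n))
      (ℤ.+-mono-<-≤ (quotient-positive ψr>0 zero n)
        (subst (0ℤ ℤ.≤_) (sym (quotient-zero (5 * suc n + r))) (ψ-nonNegative (5 * suc n + r))))
  quotient-positive ψr>0 (suc N) =
    quotient-closed (_> 0ℤ) ℤ.+-mono-< (suc N) (quotient-positive ψr>0 N)

  quotient-vanishes : (∀ n → ψ (5 * n + r) ≡ 0ℤ) → ∀ N n → quotient N (5 * n + r) ≡ 0ℤ
  quotient-vanishes ψ≡0 zero    n = trans (quotient-zero (5 * n + r)) (ψ≡0 n)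
  quotient-vanishes ψ≡0 (suc N) =
    quotient-closed (_≡ 0ℤ) (cong₂ ℤ._+_) N (quotient-vanishes ψ≡0 N)

  a-positive : ψ r > 0ℤ → ∀ n → a (5 * n + r) > 0ℤ
  -- The stage is one more than the degree, so that at least one division has taken place.
  a-positive ψr>0 n = subst (_> 0ℤ) (sym (a-limit (suc (5 * n + r)) (ℕ.n≤1+n _)))
    (quotient-positive ψr>0 (5 * n + r) n)

  a-vanishes : (∀ n → ψ (5 * n + r) ≡ 0ℤ) → ∀ n → a (5 * n + r) ≡ 0ℤ
  a-vanishes ψ≡0 n = trans (a-limit (5 * n + r) ℕ.≤-refl) (quotient-vanishes ψ≡0 (5 * n + r) n)

theorem5p1 : (n : ℕ) →
    (a (5 * n) > 0ℤ) ×
    (a (5 * n + 1) > 0ℤ) ×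
    (a (5 * n + 2) ≡ 0ℤ) ×
    (a (5 * n + 3) > 0ℤ) ×
    (a (5 * n + 4) ≡ 0ℤ)
theorem5p1 n =
  subst (λ m → a m > 0ℤ) (ℕ.+-identityʳ (5 * n)) (a-positive (ℕ.m≤m+n 1 4) 0<1 n) ,
  a-positive (ℕ.m≤m+n 2 3) 0<1 n ,
  a-vanishes (ℕ.m≤m+n 3 2) ψ[5n+2]≡0 n ,
  a-positive (ℕ.m≤m+n 4 1) 0<1 n ,
  a-vanishes (ℕ.m≤m+n 5 0) ψ[5n+4]≡0 n
  where
  -- `ψ 0`, `ψ 1` and `ψ 3` all evaluate to `1ℤ`.
  0<1 : 1ℤ > 0ℤ
  0<1 = ℤ.+<+ (s≤s z≤n)
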